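{- For any integers $w\geq 2$ and $k\geq 2w-1$, there is a graph $G$ of pathwidth $w$ such that, writing $n$ for the order of $G$, $$\operatorname{nc}(G,k)=n=(k-w+2)2^{w-1}+2k-w-2.$$
   Context: All graphs are finite, simple and undirected. $N[v]$ denotes the closed neighbourhood of $v$ ($v$ together with its neighbours). For a graph $G=(V,E)$ and $S\subseteq V$, $\operatorname{nc}(G,S)=|\{N[u]\cap S : u\in V\}|$ (the empty intersection is counted if it occurs), and $\operatorname{nc}(G,k)=\max_{S\subseteq V,\ |S|=k}\operatorname{nc}(G,S)$. Pathwidth is the usual notion: the minimum over path-decompositions (tree-decompositions whose tree is a path) of the maximum bag size minus $1$. -}

module Defs where

open import Data.Bool.Properties using () renaming (_≟_ to _≟ᵇ_)
open import Data.Fin using (Fin; _≤_; _≟_)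
open import Data.Fin.Subset using (Subset; _∈_; _∩_; ∣_∣)
open import Data.Integer using (ℤ; +_; 1ℤ; _-_) renaming (_≤_ to _≤ℤ_)
open import Data.List using (length; map; deduplicate; allFin)
open import Data.Nat using (ℕ; suc; _⊔_) renaming (_≤_ to _≤ℕ_)
open import Data.Product using (_×_; ∃-syntax)
open import Data.Vec using (tabulate)
open import Data.Vec.Functional using (foldr)
open import Data.Vec.Properties using (≡-dec)
open import Level using (0ℓ)
open import Relation.Binary using (Rel; Decidable; DecidableEquality; Symmetric)
open import Relation.Binary.PropositionalEquality using (_≡_)
open import Relation.Nullary using (¬_; does)
open import Relation.Nullary.Decidable using (_⊎-dec_)

record Graph : Set₁ where
  field
    order   : ℕ
    Adj     : Rel (Fin order) 0ℓ
    adj?    : Decidable Adj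
    symm    : Symmetric Adj
    irrefl  : ∀ v → ¬ Adj v v

  Vertex : Set
  Vertex = Fin order

  VertexSet : Set
  VertexSet = Subset order

open Graph public

N[_] : ∀ {G} → Vertex G → VertexSet G
N[_] {G} v = tabulate (λ u → does ((v ≟ u) ⊎-dec adj? G v u))

_≟ˢ_ : ∀ {n} → DecidableEquality (Subset n)
_≟ˢ_ = ≡-dec _≟ᵇ_

nc : (G : Graph) → VertexSet G → ℕ
nc G S = length (deduplicate _≟ˢ_ (map (λ u → N[_] {G} u ∩ S) (allFin (order G))))

-- nc(G,k) = m.  A relation, since there is no maximum when k > |V|.
IsNC : Graph → ℕ → ℕ → Set
IsNC G k m =
  (∃[ S ] (∣ S ∣ ≡ k × nc G S ≡ m)) ×
  (∀ (S : VertexSet G) → ∣ S ∣ ≡ k → nc G S ≤ℕ m)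

-- The nodes of the path are 0, …, last in this order, so the bags containing
-- a given vertex induce a subpath exactly when their indices form an interval.
record PathDecomposition (G : Graph) : Set where
  field
    last     : ℕ
    bag      : Fin (suc last) → VertexSet G
    vertices : ∀ v → ∃[ i ] v ∈ bag i
    edges    : ∀ {u v} → Adj G u v → ∃[ i ] (u ∈ bag i × v ∈ bag i)
    interval : ∀ {v i j l} → i ≤ j → j ≤ l → v ∈ bag i → v ∈ bag l → v ∈ bag j

  -- Integer-valued because the graph of order 0 has width -1.
  width : ℤ
  width = + foldr _⊔_ 0 (λ i → ∣ bag i ∣) - 1ℤ

open PathDecomposition public using (width)

IsPathwidth : Graph → ℤ → Set
IsPathwidth G p =
  (∃[ D ] width {G} D ≡ p) × (∀ (D : PathDecomposition G) → p ≤ℤ width D)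

{-# OPTIONS --safe #-}

-- Let S be the core s_0, …, s_{k-1}, in which every window of w consecutive vertices
-- is a clique.  Outside S one can realise every subset of every window, as well as
-- one two-element trace {s_i, s_{i+w}} between any two consecutive windows; only the first and
-- the last window are omitted, being the traces of s_0 and s_{k-1}.  All traces are then
-- distinct, so nc equals the order.  Sliding the window along the core, with a single
-- further vertex present at any time, gives pathwidth at most w.  For the lower bound,
-- contracting the edge from s_w to the vertex with trace {s_0, s_w} yields a K_{w+1} minor on it
-- and the first window; by Helly's theorem for intervals some bag meets all its branch sets.

module Submission where

open import Defs
open import Data.Empty using (⊥; ⊥-elim)
open import Data.Fin as Fin
  using (Fin; zero; suc; toℕ; fromℕ<; punchIn; punchOut; combine; finToFun; funToFin)
import Data.Fin.Properties as Finₚ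
open import Data.Fin.Subset using (Subset; inside; outside; _∈_; _∩_; ∣_∣; ⊤) renaming (⊥ to ∅)
import Data.Fin.Subset.Properties as Subsetₚ
open import Data.Integer as ℤ using (+_; 1ℤ; +≤+)
import Data.Integer.Properties as ℤₚ
open import Data.List using (List; []; _∷_; length; map; filter; allFin; deduplicate)
import Data.List.Properties as Listₚ
open import Data.List.Relation.Unary.AllPairs using ([]; _∷_)
open import Data.List.Relation.Unary.Unique.Propositional using (Unique)
import Data.List.Relation.Unary.Unique.Propositional.Properties as Uniqueₚ
open import Data.Nat
  using (ℕ; zero; suc; _+_; _*_; _∸_; _^_; _≥_; _≤_; _<_; _⊔_; _⊓_; _/_; _%_; z≤n; s≤s; _≤?_)
open import Data.Nat.DivMod using ([m+kn]%n≡m%n; m<n⇒m%n≡m; m<n*o⇒m/o<n; /-monoˡ-≤; m*n/n≡m)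
open import Data.Nat.Properties
open import Data.Nat.Tactic.RingSolver using (solve-∀)
open import Data.Product using (_×_; _,_; proj₁; proj₂; ∃-syntax)
open import Data.Sum as Sum using (_⊎_; inj₁; inj₂)
open import Data.Sum.Function.Propositional using (_⊎-↔_)
open import Data.Sum.Properties using (inj₁-injective)
open import Data.Vec using (_∷_; _++_; here; there; tabulate)
open import Data.Vec.Functional using (foldr)
import Data.Vec.Properties as Vecₚ
open import Function using (_∘_; flip)
open import Function.Bundles using (_↔_; module Inverse)
open import Function.Definitions using (Injective)
open import Function.Properties.Inverse using (↔-refl; ↔-trans)
open import Level using (0ℓ)
open import Relation.Binary using (DecidableEquality; Total; Transitive; Rel; tri<; tri≈; tri>)
open import Relation.Binary.PropositionalEquality
open import Relation.Nullary using (¬_; Dec; yes; no; does; ¬?; contradiction)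
open import Relation.Nullary.Decidable using (_×-dec_; _⊎-dec_; dec-true)

private variable
  n m : ℕ

-- Cardinalities and decidable subsets

element : (A : Subset n) → Fin ∣ A ∣ → Fin n
element (outside ∷ A) i       = suc (element A i)
element (inside  ∷ A) zero    = zero
element (inside  ∷ A) (suc i) = suc (element A i)

element-∈ : (A : Subset n) (i : Fin ∣ A ∣) → element A i ∈ A
element-∈ (outside ∷ A) i       = there (element-∈ A i)
element-∈ (inside  ∷ A) zero    = here
element-∈ (inside  ∷ A) (suc i) = there (element-∈ A i)

element-injective : (A : Subset n) → Injective _≡_ _≡_ (element A)
element-injective (outside ∷ A) eq = element-injective A (Finₚ.suc-injective eq)
element-injective (inside ∷ A) {zero}  {zero}  eq = refl
element-injective (inside ∷ A) {suc _} {suc _} eq =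
  cong suc (element-injective A (Finₚ.suc-injective eq))

rank : {A : Subset n} {x : Fin n} → x ∈ A → Fin ∣ A ∣
rank {A = inside  ∷ A} here        = zero
rank {A = inside  ∷ A} (there x∈A) = suc (rank x∈A)
rank {A = outside ∷ A} (there x∈A) = rank x∈A

rank-injective : {A : Subset n} {x y : Fin n} (x∈A : x ∈ A) (y∈A : y ∈ A) →
                 rank x∈A ≡ rank y∈A → x ≡ y
rank-injective {A = inside  ∷ A} here        here        eq = refl
rank-injective {A = inside  ∷ A} (there x∈A) (there y∈A) eq =
  cong suc (rank-injective x∈A y∈A (Finₚ.suc-injective eq))
rank-injective {A = outside ∷ A} (there x∈A) (there y∈A) eq =
  cong suc (rank-injective x∈A y∈A eq)

-- Turns a colouring with `m` colours that is injective on `A`, though perhaps not elsewhere, into a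
-- bound; bag sizes are estimated this way.
∣∣-upper : (A : Subset n) (f : Fin n → ℕ) → (∀ {x} → x ∈ A → f x < m) →
           (∀ {x y} → x ∈ A → y ∈ A → f x ≡ f y → x ≡ y) → ∣ A ∣ ≤ m
∣∣-upper A f f<m f-inj = Finₚ.injective⇒≤ {f = λ i → fromℕ< (f<m (element-∈ A i))} λ {i} {j} eq →
  element-injective A (f-inj (element-∈ A i) (element-∈ A j)
    (Finₚ.fromℕ<-injective _ _ (f<m (element-∈ A i)) (f<m (element-∈ A j)) eq))

∣∣-lower : {A : Subset n} (g : Fin m → Fin n) → Injective _≡_ _≡_ g →
           (∀ i → g i ∈ A) → m ≤ ∣ A ∣
∣∣-lower g g-inj g∈A = Finₚ.injective⇒≤ {f = rank ∘ g∈A} λ {i} {j} eq →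
  g-inj (rank-injective (g∈A i) (g∈A j) eq)

module _ {P : Fin n → Set} (P? : ∀ x → Dec (P x)) where

  ∈-tabulate⁺ : ∀ {x} → P x → x ∈ tabulate (does ∘ P?)
  ∈-tabulate⁺ {x} px =
    Vecₚ.lookup⇒[]= x _ (trans (Vecₚ.lookup∘tabulate _ x) (dec-true (P? x) px))

  ∈-tabulate⁻ : ∀ {x} → x ∈ tabulate (does ∘ P?) → P x
  ∈-tabulate⁻ {x} x∈ with P? x | trans (sym (Vecₚ.lookup∘tabulate (does ∘ P?) x)) (Vecₚ.[]=⇒lookup x∈)
  ... | yes px | _ = px
  ... | no _   | ()

∣⊤++∅∣ : ∀ k m → ∣ ⊤ {k} ++ ∅ {m} ∣ ≡ k
∣⊤++∅∣ zero    m = Subsetₚ.∣⊥∣≡0 m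
∣⊤++∅∣ (suc k) m = cong suc (∣⊤++∅∣ k m)

↑ˡ-∈-⊤++∅ : ∀ {k m} (x : Fin k) → x Fin.↑ˡ m ∈ ⊤ {k} ++ ∅ {m}
↑ˡ-∈-⊤++∅ zero    = here
↑ˡ-∈-⊤++∅ (suc x) = there (↑ˡ-∈-⊤++∅ x)

foldr-⊔-lub : (f : Fin n → ℕ) → (∀ i → f i ≤ m) → foldr _⊔_ 0 f ≤ m
foldr-⊔-lub {zero}  f f≤m = z≤n
foldr-⊔-lub {suc n} f f≤m = ⊔-lub (f≤m zero) (foldr-⊔-lub (f ∘ suc) (f≤m ∘ suc))

≤foldr-⊔ : (f : Fin n → ℕ) (i : Fin n) → f i ≤ foldr _⊔_ 0 f
≤foldr-⊔ f zero    = m≤m⊔n _ _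
≤foldr-⊔ f (suc i) = ≤-trans (≤foldr-⊔ (f ∘ suc) i) (m≤n⊔m (f zero) _)

-- Puncture at `a`, then at the place that `b` takes in the remainder. This serves to drop the codes
-- of the first and the last window.
avoidTwo : ∀ {n} {a b : Fin n} → a ≢ b →
           ∃[ f ] (Injective _≡_ _≡_ f × (∀ (i : Fin (n ∸ 2)) → f i ≢ a) × (∀ i → f i ≢ b))
avoidTwo {1} {zero} {zero} a≢b = ⊥-elim (a≢b refl)
avoidTwo {suc (suc n)} {a} {b} a≢b = f , f-inj , (λ i → Finₚ.punchInᵢ≢i a _) , f≢b
  where
  b′ = punchOut a≢b
  f : Fin n → Fin (suc (suc n))
  f i = punchIn a (punchIn b′ i)
  f-inj : Injective _≡_ _≡_ f
  f-inj eq = Finₚ.punchIn-injective b′ _ _ (Finₚ.punchIn-injective a _ _ eq)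
  f≢b : ∀ i → f i ≢ b
  f≢b i eq = Finₚ.punchInᵢ≢i b′ i
    (Finₚ.punchIn-injective a _ _ (trans eq (sym (Finₚ.punchIn-punchOut a≢b))))

-- Replaces function extensionality: digits agreeing pointwise already give equal codes.
funToFin-cong : {f g : Fin n → Fin m} → (∀ i → f i ≡ g i) → funToFin f ≡ funToFin g
funToFin-cong {zero}  f≗g = refl
funToFin-cong {suc n} f≗g = cong₂ combine (f≗g zero) (funToFin-cong (f≗g ∘ suc))

finToFun-injective : {i j : Fin (m ^ n)} →
                     (∀ t → finToFun {m} {n} i t ≡ finToFun j t) → i ≡ j
finToFun-injective {m} {n} {i} {j} eq = begin
  i                                ≡⟨ Finₚ.funToFin-finToFin {n} {m} i ⟨
  funToFin (finToFun {m} {n} i)    ≡⟨ funToFin-cong eq ⟩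
  funToFin (finToFun {m} {n} j)    ≡⟨ Finₚ.funToFin-finToFin {n} {m} j ⟩
  j                                ∎
  where open ≡-Reasoning

-- Neighbourhood complexity

deduplicate-unique : {A : Set} (_≟_ : DecidableEquality A) {xs : List A} →
                     Unique xs → deduplicate _≟_ xs ≡ xs
deduplicate-unique _≟_ []           = refl
deduplicate-unique _≟_ {x ∷ xs} (x∉xs ∷ xs!) = cong (x ∷_)
  (trans (cong (filter (λ y → ¬? (x ≟ y))) (deduplicate-unique _≟_ xs!))
         (Listₚ.filter-all (λ y → ¬? (x ≟ y)) x∉xs))

module _ (G : Graph) where

  traces : VertexSet G → List (VertexSet G)
  traces S = map (λ u → N[_] {G} u ∩ S) (allFin (order G))

  length-traces : ∀ S → length (traces S) ≡ order G
  length-traces S = trans (Listₚ.length-map _ (allFin (order G)))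
                          (Listₚ.length-tabulate {n = order G} (λ u → u))

  -- The list of traces has one entry per vertex. On `S` it has no repetitions, so deduplication
  -- changes nothing; on any other set deduplication can only shorten it.
  isNC-order : ∀ {k} (S : VertexSet G) → ∣ S ∣ ≡ k →
               Injective _≡_ _≡_ (λ u → N[_] {G} u ∩ S) → IsNC G k (order G)
  isNC-order S ∣S∣≡k inj =
    (S , ∣S∣≡k ,
      trans (cong length (deduplicate-unique _≟ˢ_ (Uniqueₚ.map⁺ inj (Uniqueₚ.allFin⁺ _))))
            (length-traces S)) ,
    λ S′ _ → ≤-trans (Listₚ.length-deduplicate _≟ˢ_ (traces S′))
                     (≤-reflexive (length-traces S′))

-- Pathwidth

-- The order is abstract so that flipping it yields maxima as well as minima.
extremum : {A : Set} {_≼_ : Rel A 0ℓ} → Total _≼_ → Transitive _≼_ →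
           (f : Fin (suc n) → A) → ∃[ i ] (∀ j → f i ≼ f j)
extremum {zero}  total ≼-trans f =
  -- Totality at a repeated argument gives reflexivity, both alternatives being the same.
  zero , λ { zero → Sum.reduce (total (f zero) (f zero)) }
extremum {suc n} total ≼-trans f with extremum total ≼-trans (f ∘ suc)
... | i , fi≼ with total (f zero) (f (suc i))
...   | inj₁ f0≼fi = zero , λ { zero    → Sum.reduce (total (f zero) (f zero))
                              ; (suc j) → ≼-trans f0≼fi (fi≼ j) }
...   | inj₂ fi≼f0 = suc i , λ { zero → fi≼f0 ; (suc j) → fi≼ j }

-- The common point is max_i min_j of the points chosen in P i ∩ P j.
helly : ∀ {l} (P : Fin (suc n) → Fin l → Set) →
        (∀ i {a b c} → a Fin.≤ b → b Fin.≤ c → P i a → P i c → P i b) →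
        (∀ i j → ∃[ x ] (P i x × P j x)) →
        ∃[ x ] (∀ i → P i x)
helly P convex meet = point i₀ (low i₀) , λ i →
  -- The chosen point lies between `point i (low i)`, by maximality of `i₀`, and `point i₀ i`, by
  -- minimality of `low i₀`; both of these are in `P i`.
  convex i (proj₂ i₀-max i) (proj₂ (low′ i₀) i)
    (proj₁ (proj₂ (meet i (low i)))) (proj₂ (proj₂ (meet i₀ i)))
  where
  point = λ i j → proj₁ (meet i j)
  low′ = λ i → extremum Finₚ.≤-total Finₚ.≤-trans (point i)
  low = λ i → proj₁ (low′ i)
  i₀-max = extremum (flip Finₚ.≤-total) (flip Finₚ.≤-trans) (λ i → point i (low i))
  i₀ = proj₁ i₀-max

module _ {G : Graph} where
  open PathDecomposition

  width-≤ : ∀ {w} (D : PathDecomposition G) → (∀ i → ∣ bag D i ∣ ≤ suc w) → width D ℤ.≤ + w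
  -- The integer `+ suc w - 1ℤ` reduces to `+ w`.
  width-≤ D bag≤ = ℤₚ.+-monoˡ-≤ (ℤ.- 1ℤ) (+≤+ (foldr-⊔-lub _ bag≤))

  ≤-width : ∀ {w} (D : PathDecomposition G) i → suc w ≤ ∣ bag D i ∣ → + w ℤ.≤ width D
  ≤-width D i ≤bag = ℤₚ.+-monoˡ-≤ (ℤ.- 1ℤ) (+≤+ (≤-trans ≤bag (≤foldr-⊔ (λ i → ∣ bag D i ∣) i)))

  isPathwidth : ∀ {w} (D : PathDecomposition G) → (∀ i → ∣ bag D i ∣ ≤ suc w) →
                (∀ (D : PathDecomposition G) → ∃[ i ] suc w ≤ ∣ bag D i ∣) → IsPathwidth G (+ w)
  isPathwidth {w} D bag≤ lower = (D , ℤₚ.≤-antisym (width-≤ D bag≤) (+w≤width D)) , +w≤width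
    where
    +w≤width : ∀ D → + w ℤ.≤ width D
    +w≤width D = let i , ≤bag = lower D in ≤-width D i ≤bag

-- Path decompositions from intervals of time

module _ (G : Graph) (lo hi : Vertex G → ℕ) (last : ℕ)
         (lo≤hi : ∀ v → lo v ≤ hi v) (lo≤last : ∀ v → lo v ≤ last)
         (meets : ∀ {u v} → Adj G u v → lo u ≤ hi v) where

  active? : ∀ (j : Fin (suc last)) v → Dec (lo v ≤ toℕ j × toℕ j ≤ hi v)
  active? j v = (lo v ≤? toℕ j) ×-dec (toℕ j ≤? hi v)

  intervalDecomposition : PathDecomposition G
  intervalDecomposition = record
    { last     = last
    ; bag      = λ j → tabulate (does ∘ active? j)
    ; vertices = λ v → at (lo≤last v) , ∈-tabulate⁺ (active? (at (lo≤last v)))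
        (subst (λ t → lo v ≤ t × t ≤ hi v) (sym (toℕ-at (lo≤last v))) (≤-refl , lo≤hi v))
    -- Intervals that meet share the larger of their left ends; symmetry of adjacency gives `meets`
    -- in the other direction.
    ; edges    = λ {u} {v} uv → let t≤last = ⊔-lub (lo≤last u) (lo≤last v) in
        at t≤last ,
        ∈-tabulate⁺ (active? (at t≤last))
          (subst (λ t → lo u ≤ t × t ≤ hi u) (sym (toℕ-at t≤last))
            (m≤m⊔n _ _ , ⊔-lub (lo≤hi u) (meets (symm G uv)))) ,
        ∈-tabulate⁺ (active? (at t≤last))
          (subst (λ t → lo v ≤ t × t ≤ hi v) (sym (toℕ-at t≤last))
            (m≤n⊔m (lo u) (lo v) , ⊔-lub (meets uv) (lo≤hi v)))
    ; interval = λ {v} {i} {j} {l} i≤j j≤l v∈i v∈l →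
        ∈-tabulate⁺ (active? j)
          (≤-trans (proj₁ (∈-tabulate⁻ (active? i) v∈i)) i≤j ,
           ≤-trans j≤l (proj₂ (∈-tabulate⁻ (active? l) v∈l)))
    }
    where
    at : ∀ {t} → t ≤ last → Fin (suc last)
    at t≤last = fromℕ< (s≤s t≤last)
    toℕ-at : ∀ {t} (t≤last : t ≤ last) → toℕ (at t≤last) ≡ t
    toℕ-at t≤last = Finₚ.toℕ-fromℕ< (s≤s t≤last)

-- The graph

-- With w = p + 1 and k = w + d: the core vertices 0, …, k - 1 form S and x, y
-- are adjacent when |x - y| ≤ p, the i-th bridge is joined to i and i + w, and
-- there is one further vertex for each subset of a window {i, …, i + p}
-- (0 ≤ i ≤ d) other than the whole first and the whole last window, which are
-- already the closed neighbourhoods of the first and of the last core vertex.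
module Construction (p d : ℕ) (1≤p : 1 ≤ p) (p≤d : p ≤ d) where

  k : ℕ
  k = suc (d + p)

  0<d : 0 < d
  0<d = ≤-trans 1≤p p≤d

  -- A subset of a window is coded by the last window containing it, so it
  -- contains the start of that window unless this is d.
  Code : Set
  Code = (Fin d × Fin (2 ^ p)) ⊎ Fin (2 ^ suc p)

  start : Code → ℕ
  start (inj₁ (i , _)) = toℕ i
  start (inj₂ _)       = d

  chosen : Code → Fin (suc p) → Fin 2
  chosen (inj₁ (_ , b)) zero    = suc zero
  chosen (inj₁ (_ , b)) (suc t) = finToFun {2} {p} b t
  chosen (inj₂ b)       t       = finToFun {2} {suc p} b t

  Covers : Code → ℕ → Set
  Covers c y = ∃[ t ] (chosen c t ≡ suc zero × y ≡ start c + toℕ t)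

  covers? : ∀ c y → Dec (Covers c y)
  covers? c y = Finₚ.any? λ t → (chosen c t Fin.≟ suc zero) ×-dec (y ≟ start c + toℕ t)

  start≤d : ∀ c → start c ≤ d
  start≤d (inj₁ (i , _)) = <⇒≤ (Finₚ.toℕ<n i)
  start≤d (inj₂ _)       = ≤-refl

  covers⇒start≤ : ∀ c {y} → Covers c y → start c ≤ y
  covers⇒start≤ c (t , _ , refl) = m≤m+n _ _

  covers⇒≤end : ∀ c {y} → Covers c y → y ≤ start c + p
  covers⇒≤end c (t , _ , refl) = +-monoʳ-≤ (start c) (Finₚ.toℕ≤pred[n] t)

  covers⇒<k : ∀ c {y} → Covers c y → y < k
  covers⇒<k c cy = s≤s (≤-trans (covers⇒≤end c cy) (+-monoˡ-≤ p (start≤d c)))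

  covers-start : ∀ c → start c < d → Covers c (start c)
  covers-start (inj₁ (i , _)) _   = zero , refl , sym (+-identityʳ (toℕ i))
  covers-start (inj₂ _)       d<d = contradiction d<d (<-irrefl refl)

  covers⇒chosen : ∀ c {t} → Covers c (start c + toℕ t) → chosen c t ≡ suc zero
  covers⇒chosen c {t} (t′ , t′∈c , eq) =
    trans (cong (chosen c) (Finₚ.toℕ-injective (+-cancelˡ-≡ (start c) _ _ eq))) t′∈c

  chosen-injective : ∀ c c′ → start c ≡ start c′ → (∀ t → chosen c t ≡ chosen c′ t) → c ≡ c′
  chosen-injective (inj₁ (i , b)) (inj₁ (i′ , b′)) i≡i′ eq =
    cong₂ (λ i b → inj₁ (i , b)) (Finₚ.toℕ-injective i≡i′) (finToFun-injective {2} {p} (eq ∘ suc))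
  chosen-injective (inj₁ (i , _)) (inj₂ _) i≡d _ = contradiction (Finₚ.toℕ<n i) (<-irrefl i≡d)
  chosen-injective (inj₂ _) (inj₁ (i , _)) d≡i _ = contradiction (Finₚ.toℕ<n i) (<-irrefl (sym d≡i))
  chosen-injective (inj₂ b) (inj₂ b′) _ eq = cong inj₂ (finToFun-injective {2} {suc p} eq)

  infix 4 _⊑_
  -- Only positions below `k` are compared, since a trace on the core sees no others.
  _⊑_ : (ℕ → Set) → (ℕ → Set) → Set
  A ⊑ B = ∀ {y} → y < k → A y → B y

  -- A start below `d` is itself an element, hence lies in the larger set; a start equal to `d` is
  -- the greatest possible.
  ⊑⇒start≥ : ∀ c c′ → Covers c ⊑ Covers c′ → start c′ ≤ start c
  ⊑⇒start≥ c c′ c⊑c′ with m≤n⇒m<n∨m≡n (start≤d c)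
  ... | inj₁ s<d = covers⇒start≤ c′ (c⊑c′ (covers⇒<k c (covers-start c s<d)) (covers-start c s<d))
  ... | inj₂ s≡d = ≤-trans (start≤d c′) (≤-reflexive (sym s≡d))

  -- The coding is canonical: equal sets have equal starts, after which the digits can be compared
  -- position by position.
  covers-injective : ∀ c c′ → Covers c ⊑ Covers c′ → Covers c′ ⊑ Covers c → c ≡ c′
  covers-injective c c′ c⊑c′ c′⊑c =
    chosen-injective c c′ s≡s′ λ t → binary (mono c c′ s≡s′ c⊑c′ t) (mono c′ c (sym s≡s′) c′⊑c t)
    where
    s≡s′ : start c ≡ start c′
    s≡s′ = ≤-antisym (⊑⇒start≥ c′ c c′⊑c) (⊑⇒start≥ c c′ c⊑c′)
    mono : ∀ c c′ → start c ≡ start c′ → Covers c ⊑ Covers c′ →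
           ∀ t → chosen c t ≡ suc zero → chosen c′ t ≡ suc zero
    mono c c′ s≡s′ c⊑c′ t t∈c = covers⇒chosen c′
      (subst (λ s → Covers c′ (s + toℕ t)) s≡s′ (c⊑c′ (covers⇒<k c (t , t∈c , refl)) (t , t∈c , refl)))
    binary : ∀ {a b : Fin 2} → (a ≡ suc zero → b ≡ suc zero) → (b ≡ suc zero → a ≡ suc zero) → a ≡ b
    binary {zero}     {zero}     _   _   = refl
    binary {zero}     {suc zero} _   b⇒a = b⇒a refl
    binary {suc zero} {zero}     a⇒b _   = sym (a⇒b refl)
    binary {suc zero} {suc zero} _   _   = refl

  -- Since 0 < `d`, the start of the first window is implicit and only `p` digits are stored; the
  -- last window stores all `p + 1`.
  firstWindow lastWindow : Code
  firstWindow = inj₁ (fromℕ< 0<d , funToFin {p} (λ _ → suc zero))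
  lastWindow  = inj₂ (funToFin {suc p} (λ _ → suc zero))

  Full : Code → Set
  Full c = ∀ t → chosen c t ≡ suc zero

  firstWindow-full : Full firstWindow
  firstWindow-full zero    = refl
  firstWindow-full (suc t) = Finₚ.finToFun-funToFin (λ _ → suc zero) t

  lastWindow-full : Full lastWindow
  lastWindow-full = Finₚ.finToFun-funToFin (λ _ → suc zero)

  full⇒covers : ∀ c {y} → Full c → start c ≤ y → y ≤ start c + p → Covers c y
  full⇒covers c {y} full s≤y y≤s+p = fromℕ< t<w , full _ ,
    trans (sym (m+[n∸m]≡n s≤y)) (cong (_+_ (start c)) (sym (Finₚ.toℕ-fromℕ< t<w)))
    where
    t<w : y ∸ start c < suc p
    t<w = s≤s (m≤n+o⇒m∸n≤o y (start c) y≤s+p)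

  -- Having the same start confines `c` to the window of `c′`, so covering that window leaves no
  -- choice.
  full-unique : ∀ c c′ → Full c′ → start c ≡ start c′ →
                (∀ {y} → start c′ ≤ y → y ≤ start c′ + p → Covers c y) → c ≡ c′
  full-unique c c′ full s≡s′ all = covers-injective c c′
    (λ _ cy → full⇒covers c′ full (subst (_≤ _) s≡s′ (covers⇒start≤ c cy))
                                  (subst (λ s → _ ≤ s + p) s≡s′ (covers⇒≤end c cy)))
    (λ _ c′y → all (covers⇒start≤ c′ c′y) (covers⇒≤end c′ c′y))

  -- Enumeration of the window subsets that are kept

  codes : ℕ
  codes = d * 2 ^ p + 2 ^ suc p

  codes↔Code : Fin codes ↔ Code
  codes↔Code = ↔-trans (Finₚ.+↔⊎ {d * 2 ^ p}) (Finₚ.*↔× {d} ⊎-↔ ↔-refl)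

  open Inverse codes↔Code renaming
    (to to decode; from to encode; strictlyInverseˡ to decode-encode; strictlyInverseʳ to encode-decode)
    using ()

  first≢last : encode firstWindow ≢ encode lastWindow
  first≢last eq with trans (sym (decode-encode firstWindow)) (trans (cong decode eq) (decode-encode lastWindow))
  ... | ()

  windows : ℕ
  windows = codes ∸ 2

  kept : Fin windows → Code
  kept = decode ∘ proj₁ (avoidTwo first≢last)

  kept-injective : Injective _≡_ _≡_ kept
  kept-injective eq = proj₁ (proj₂ (avoidTwo first≢last))
    (trans (sym (encode-decode _)) (trans (cong encode eq) (encode-decode _)))

  kept≢first : ∀ c → kept c ≢ firstWindow
  kept≢first c eq = proj₁ (proj₂ (proj₂ (avoidTwo first≢last))) c
    (trans (sym (encode-decode _)) (cong encode eq))

  kept≢last : ∀ c → kept c ≢ lastWindow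
  kept≢last c eq = proj₂ (proj₂ (proj₂ (avoidTwo first≢last))) c
    (trans (sym (encode-decode _)) (cong encode eq))

  -- Vertices and adjacency

  Role : Set
  Role = Fin k ⊎ (Fin d ⊎ Fin windows)

  pattern core x   = inj₁ x
  pattern bridge i = inj₂ (inj₁ i)
  pattern window c = inj₂ (inj₂ c)

  size : ℕ
  size = k + (d + windows)

  vertex↔Role : Fin size ↔ Role
  vertex↔Role = ↔-trans (Finₚ.+↔⊎ {k}) (↔-refl ⊎-↔ Finₚ.+↔⊎ {d})

  open Inverse vertex↔Role renaming
    (to to role; from to vertex; strictlyInverseˡ to role-vertex; strictlyInverseʳ to vertex-role)
    using ()

  role-injective : ∀ {u v} → role u ≡ role v → u ≡ v
  role-injective {u} {v} eq = trans (sym (vertex-role u)) (trans (cong vertex eq) (vertex-role v))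

  -- Membership of the y-th core vertex in the closed neighbourhood.
  Near : Role → ℕ → Set
  Near (core x)   y = y ≤ toℕ x + p × toℕ x ≤ y + p
  Near (bridge i) y = y ≡ toℕ i ⊎ y ≡ suc (toℕ i + p)
  Near (window c) y = Covers (kept c) y

  near? : ∀ r y → Dec (Near r y)
  near? (core x)   y = (y ≤? toℕ x + p) ×-dec (toℕ x ≤? y + p)
  near? (bridge i) y = (y ≟ toℕ i) ⊎-dec (y ≟ suc (toℕ i + p))
  near? (window c) y = covers? (kept c) y

  RoleAdj : Role → Role → Set
  RoleAdj (core x) (core y) = x ≢ y × Near (core x) (toℕ y)
  RoleAdj (core x) (inj₂ o) = Near (inj₂ o) (toℕ x)
  RoleAdj (inj₂ o) (core y) = Near (inj₂ o) (toℕ y)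
  RoleAdj (inj₂ _) (inj₂ _) = ⊥

  roleAdj? : ∀ r r′ → Dec (RoleAdj r r′)
  roleAdj? (core x) (core y) = ¬? (x Fin.≟ y) ×-dec near? (core x) (toℕ y)
  roleAdj? (core x) (inj₂ o) = near? (inj₂ o) (toℕ x)
  roleAdj? (inj₂ o) (core y) = near? (inj₂ o) (toℕ y)
  roleAdj? (inj₂ _) (inj₂ _) = no λ ()

  roleAdj-sym : ∀ r r′ → RoleAdj r r′ → RoleAdj r′ r
  roleAdj-sym (core x) (core y) (x≢y , y≤ , x≤) = x≢y ∘ sym , x≤ , y≤
  roleAdj-sym (core x) (inj₂ o) near = near
  roleAdj-sym (inj₂ o) (core y) near = near

  roleAdj-irrefl : ∀ r → ¬ RoleAdj r r
  roleAdj-irrefl (core x) (x≢x , _) = x≢x refl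

  graph : Graph
  graph = record
    { order  = size
    ; Adj    = λ u v → RoleAdj (role u) (role v)
    ; adj?   = λ u v → roleAdj? (role u) (role v)
    ; symm   = λ {u} {v} → roleAdj-sym (role u) (role v)
    ; irrefl = λ v → roleAdj-irrefl (role v)
    }

  roleAdj⇒near : ∀ r y → RoleAdj r (core y) → Near r (toℕ y)
  roleAdj⇒near (core x) y (_ , near) = near
  roleAdj⇒near (inj₂ o) y near       = near

  near⇒roleAdj : ∀ r y → Near r (toℕ y) → r ≡ core y ⊎ RoleAdj r (core y)
  near⇒roleAdj (core x) y near with x Fin.≟ y
  ... | yes x≡y = inj₁ (cong core x≡y)
  ... | no  x≢y = inj₂ (x≢y , near)
  near⇒roleAdj (inj₂ o) y near = inj₂ near

  ∈N⇒near : ∀ u y → vertex (core y) ∈ N[_] {graph} u → Near (role u) (toℕ y)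
  ∈N⇒near u y y∈N with ∈-tabulate⁻ (λ v → (u Fin.≟ v) ⊎-dec adj? graph u v) y∈N
  ... | inj₁ refl = subst (λ r → Near r (toℕ y)) (sym (role-vertex (core y))) (m≤m+n _ _ , m≤m+n _ _)
  ... | inj₂ adj  = roleAdj⇒near (role u) y (subst (RoleAdj (role u)) (role-vertex (core y)) adj)

  near⇒∈N : ∀ u y → Near (role u) (toℕ y) → vertex (core y) ∈ N[_] {graph} u
  near⇒∈N u y near = ∈-tabulate⁺ (λ v → (u Fin.≟ v) ⊎-dec adj? graph u v)
    (Sum.map (λ eq → trans (sym (vertex-role u)) (cong vertex eq))
             (subst (RoleAdj (role u)) (sym (role-vertex (core y))))
             (near⇒roleAdj (role u) y near))

  -- The closed neighbourhoods are distinct on the core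

  -- If `p ≤ x`, then `x - p` is near `x` but too far from `x′`. Otherwise `x < p ≤ d`, and
  -- `min x′ d + p` is near `x′` but too far from `x`; the cap `d` keeps this witness inside the
  -- core.
  core-core : ∀ x x′ → toℕ x < toℕ x′ →
              Near (core x) ⊑ Near (core x′) → Near (core x′) ⊑ Near (core x) → ⊥
  core-core x x′ x<x′ x⊑x′ x′⊑x with p ≤? toℕ x
  ... | yes p≤x = <⇒≱ x<x′ (subst (toℕ x′ ≤_) (m∸n+n≡m p≤x)
          (proj₂ (x⊑x′ {toℕ x ∸ p} (≤-<-trans (m∸n≤m _ p) (Finₚ.toℕ<n x))
                   (≤-trans (m∸n≤m _ p) (m≤m+n _ p) , ≤-reflexive (sym (m∸n+n≡m p≤x))))))
  ... | no  p≰x = <⇒≱ (⊓-glb x<x′ (≤-trans (≰⇒> p≰x) p≤d))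
          (+-cancelʳ-≤ p _ _ (proj₁ (x′⊑x {toℕ x′ ⊓ d + p} (s≤s (+-monoˡ-≤ p (m⊓n≤n _ d)))
            (+-monoˡ-≤ p (m⊓n≤m _ d) , x′≤))))
    where
    x′≤ : toℕ x′ ≤ toℕ x′ ⊓ d + p + p
    x′≤ with ≤-total (toℕ x′) d
    ... | inj₁ x′≤d rewrite m≤n⇒m⊓n≡m x′≤d = ≤-trans (m≤m+n _ p) (m≤m+n _ p)
    ... | inj₂ d≤x′ rewrite m≥n⇒m⊓n≡n d≤x′ = ≤-trans (≤-pred (Finₚ.toℕ<n x′)) (m≤m+n _ p)

  bridge-end<k : ∀ i → suc (toℕ i + p) < k
  bridge-end<k i = s≤s (+-monoˡ-≤ p (Finₚ.toℕ<n {d} i))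

  bridge-start<k : ∀ i → toℕ i < k
  bridge-start<k i = s≤s (≤-trans (m≤m+n _ p) (<⇒≤ (≤-pred (bridge-end<k i))))

  -- Being near itself, `x` must be an end of the bridge, but the other end is `p + 1` away.
  core-bridge : ∀ x i → Near (core x) ⊑ Near (bridge i) → Near (bridge i) ⊑ Near (core x) → ⊥
  core-bridge x i x⊑i i⊑x with x⊑i (Finₚ.toℕ<n x) (m≤m+n _ p , m≤m+n _ p)
  ... | inj₁ x≡i = <-irrefl (sym x≡i) (+-cancelʳ-≤ p _ _ (proj₁ (i⊑x (bridge-end<k i) (inj₂ refl))))
  ... | inj₂ x≡i+w = <-irrefl refl (subst (_≤ toℕ i + p) x≡i+w (proj₂ (i⊑x (bridge-start<k i) (inj₁ refl))))

  ⊑⇒start≤ : ∀ x c → Near (core x) ⊑ Covers c → start c ≤ toℕ x ∸ p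
  ⊑⇒start≤ x c x⊑c = covers⇒start≤ c (x⊑c (≤-<-trans (m∸n≤m _ p) (Finₚ.toℕ<n x))
    (≤-trans (m∸n≤m _ p) (m≤m+n _ p) , ≤-trans (m≤n+m∸n (toℕ x) p) (≤-reflexive (+-comm p _))))

  -- Identifies the codes that had to be dropped. If `x ≤ d`, then `x + p` is in the core, so
  -- `x ≤ start c ≤ x ∸ p`, and `p ≥ 1` forces `x = 0`. If `d ≤ x`, the last core vertex `d + p` is
  -- near `x`, so `start c = d`, and `d ≤ x ∸ p` forces `x = d + p`.
  core-window : ∀ x c → Near (core x) ⊑ Covers c → Covers c ⊑ Near (core x) →
                c ≡ firstWindow ⊎ c ≡ lastWindow
  core-window x c x⊑c c⊑x with ≤-total (toℕ x) d
  ... | inj₁ x≤d = inj₁ (full-unique c firstWindow firstWindow-full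
          (trans (n≤0⇒n≡0 (subst (start c ≤_) x≡0 s≤x)) (sym first-start))
          (λ {y} _ y≤p → let y≤p′ = subst (λ s → y ≤ s + p) first-start y≤p in
             x⊑c (s≤s (≤-trans y≤p′ (m≤n+m p d)))
                 (≤-trans y≤p′ (m≤n+m p _) , subst (_≤ y + p) (sym x≡0) z≤n)))
    where
    first-start : start firstWindow ≡ 0
    first-start = Finₚ.toℕ-fromℕ< 0<d
    low : start c ≤ toℕ x ∸ p
    low = ⊑⇒start≤ x c x⊑c
    s≤x : start c ≤ toℕ x
    s≤x = ≤-trans low (m∸n≤m _ p)
    x≤s : toℕ x ≤ start c
    x≤s = +-cancelʳ-≤ p _ _ (covers⇒≤end c (x⊑c (s≤s (+-monoˡ-≤ p x≤d)) (≤-refl , ≤-trans (m≤m+n _ p) (m≤m+n _ p))))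
    x≡0 : toℕ x ≡ 0
    x≡0 with toℕ x | ≤-trans x≤s low
    ... | zero   | _    = refl
    ... | suc x₀ | x<x₀ = contradiction (≤-trans x<x₀ (∸-monoʳ-≤ (suc x₀) 1≤p)) (<-irrefl refl)
  ... | inj₂ d≤x = inj₂ (full-unique c lastWindow lastWindow-full s≡d
          (λ {y} d≤y y≤d+p → x⊑c (s≤s y≤d+p)
            (≤-trans y≤d+p (≤-trans d+p≤x (m≤m+n _ p)) ,
             ≤-trans (≤-pred (Finₚ.toℕ<n x)) (+-monoˡ-≤ p d≤y))))
    where
    low : start c ≤ toℕ x ∸ p
    low = ⊑⇒start≤ x c x⊑c
    s≡d : start c ≡ d
    s≡d = ≤-antisym (start≤d c) (+-cancelʳ-≤ p _ _ (covers⇒≤end c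
      (x⊑c ≤-refl (+-monoˡ-≤ p d≤x , ≤-trans (≤-pred (Finₚ.toℕ<n x)) (m≤m+n _ p)))))
    d+p≤x : d + p ≤ toℕ x
    d+p≤x = subst (d + p ≤_) (m∸n+n≡m (≤-trans p≤d d≤x)) (+-monoˡ-≤ p (subst (_≤ toℕ x ∸ p) s≡d low))

  -- Either the left ends agree, or each left end is the right end of the other bridge, which is
  -- cyclic.
  bridge-bridge : ∀ i i′ → Near (bridge i) ⊑ Near (bridge i′) → Near (bridge i′) ⊑ Near (bridge i) → i ≡ i′
  bridge-bridge i i′ i⊑i′ i′⊑i with i⊑i′ (bridge-start<k i) (inj₁ refl) | i′⊑i (bridge-start<k i′) (inj₁ refl)
  ... | inj₁ i≡i′ | _         = Finₚ.toℕ-injective i≡i′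
  ... | inj₂ _    | inj₁ i′≡i = Finₚ.toℕ-injective (sym i′≡i)
  ... | inj₂ i≡   | inj₂ i′≡  = contradiction (m<m+p i′≡) (<-asym (m<m+p i≡))
    where
    m<m+p : ∀ {a b} → a ≡ suc (b + p) → b < a
    m<m+p refl = s≤s (m≤m+n _ p)

  -- The ends of a bridge differ by `p + 1`, the elements of a window by at most `p`.
  bridge-window : ∀ i c → Near (bridge i) ⊑ Covers c → ⊥
  bridge-window i c i⊑c = <⇒≱ (n<1+n _)
    (≤-trans (covers⇒≤end c (i⊑c (bridge-end<k i) (inj₂ refl)))
             (+-monoˡ-≤ p (covers⇒start≤ c (i⊑c (bridge-start<k i) (inj₁ refl)))))

  near-injective : ∀ r r′ → Near r ⊑ Near r′ → Near r′ ⊑ Near r → r ≡ r′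
  near-injective (core x) (core x′) f g with <-cmp (toℕ x) (toℕ x′)
  ... | tri< x<x′ _ _ = ⊥-elim (core-core x x′ x<x′ f g)
  ... | tri≈ _ x≡x′ _ = cong core (Finₚ.toℕ-injective x≡x′)
  ... | tri> _ _ x′<x = ⊥-elim (core-core x′ x x′<x g f)
  near-injective (core x)   (bridge i)  f g = ⊥-elim (core-bridge x i f g)
  near-injective (bridge i) (core x)    f g = ⊥-elim (core-bridge x i g f)
  near-injective (core x)   (window c)  f g =
    ⊥-elim (Sum.[ kept≢first c , kept≢last c ] (core-window x (kept c) f g))
  near-injective (window c) (core x)    f g =
    ⊥-elim (Sum.[ kept≢first c , kept≢last c ] (core-window x (kept c) g f))
  near-injective (bridge i) (bridge i′) f g = cong bridge (bridge-bridge i i′ f g)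
  near-injective (bridge i) (window c)  f g = ⊥-elim (bridge-window i (kept c) f)
  near-injective (window c) (bridge i)  f g = ⊥-elim (bridge-window i (kept c) g)
  near-injective (window c) (window c′) f g =
    cong window (kept-injective (covers-injective (kept c) (kept c′) f g))

  -- The enumeration of vertices puts the core first, so `vertex (core x)` reduces to an `↑ˡ`.
  coreSet : VertexSet graph
  coreSet = ⊤ {k} ++ ∅ {d + windows}

  trace-injective : Injective _≡_ _≡_ (λ u → N[_] {graph} u ∩ coreSet)
  trace-injective {u} {v} eq = role-injective (near-injective (role u) (role v) (incl u v eq) (incl v u (sym eq)))
    where
    incl : ∀ u v → N[_] {graph} u ∩ coreSet ≡ N[_] {graph} v ∩ coreSet → Near (role u) ⊑ Near (role v)
    incl u v eq {y} y<k near = subst (Near (role v)) (Finₚ.toℕ-fromℕ< y<k)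
      (∈N⇒near v x (proj₁ (Subsetₚ.x∈p∩q⁻ _ coreSet (subst (vertex (core x) ∈_) eq
        (Subsetₚ.x∈p∩q⁺ (near⇒∈N u x (subst (Near (role u)) (sym (Finₚ.toℕ-fromℕ< y<k)) near) , ↑ˡ-∈-⊤++∅ x))))))
      where x = fromℕ< y<k

  graph-isNC : IsNC graph k (order graph)
  graph-isNC = isNC-order graph coreSet (∣⊤++∅∣ k (d + windows)) trace-injective

  -- The pathwidth is at most w

  -- Window {i, …, i + p} occupies the times from i * stride up to (i + 1) * stride - 1.
  -- Its subsets are visited one at a time strictly inside this period, while the
  -- i-th bridge is present at the last moment of period i and the first of period i + 1.
  stride : ℕ
  stride = suc (suc windows)

  -- Core vertex `x` is present from period `x ∸ p` to the end of period `x`. Window vertices use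
  -- the offsets 1 to `windows`; the offsets 0 and `suc windows` are left to the bridges.
  lo hi : Role → ℕ
  lo (core x)   = (toℕ x ∸ p) * stride
  lo (bridge i) = suc windows + toℕ i * stride
  lo (window c) = suc (toℕ c) + start (kept c) * stride
  hi (core x)   = suc windows + toℕ x * stride
  hi (bridge i) = suc (toℕ i) * stride
  hi (window c) = suc (toℕ c) + start (kept c) * stride

  lo≤hi : ∀ r → lo r ≤ hi r
  lo≤hi (core x)   = ≤-trans (*-monoˡ-≤ stride (m∸n≤m (toℕ x) p)) (m≤n+m _ _)
  lo≤hi (bridge i) = n≤1+n _
  lo≤hi (window c) = ≤-refl

  lo≤end : ∀ r → lo r ≤ k * stride
  lo≤end (core x)   = *-monoˡ-≤ stride (≤-trans (m∸n≤m (toℕ x) p) (<⇒≤ (Finₚ.toℕ<n x)))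
  lo≤end (bridge i) = ≤-trans (lo≤hi (bridge i)) (*-monoˡ-≤ stride (bridge-start<k i))
  lo≤end (window c) = ≤-trans
    (+-monoˡ-≤ (start (kept c) * stride) (s≤s (≤-trans (<⇒≤ (Finₚ.toℕ<n c)) (n≤1+n windows))))
    (*-monoˡ-≤ stride (s≤s (≤-trans (start≤d (kept c)) (m≤m+n d p))))

  -- The tight cases are the bridges: bridge `i` appears at the last moment of core vertex `i` and
  -- ends at the first moment of core vertex `i + p + 1`.
  roleAdj⇒meets : ∀ r r′ → RoleAdj r r′ → lo r ≤ hi r′
  roleAdj⇒meets (core x) (core y) (_ , _ , x≤y+p) =
    ≤-trans (*-monoˡ-≤ stride (m≤n+o⇒m∸n≤o (toℕ x) p (subst (toℕ x ≤_) (+-comm _ p) x≤y+p))) (m≤n+m _ _)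
  roleAdj⇒meets (core x) (bridge i) near =
    *-monoˡ-≤ stride (m≤n+o⇒m∸n≤o (toℕ x) p (subst (toℕ x ≤_) (+-comm _ p) (x≤ near)))
    where
    x≤ : Near (bridge i) (toℕ x) → toℕ x ≤ suc (toℕ i + p)
    x≤ (inj₁ x≡) = ≤-trans (≤-reflexive x≡) (≤-trans (m≤m+n _ p) (n≤1+n _))
    x≤ (inj₂ x≡) = ≤-reflexive x≡
  roleAdj⇒meets (core x) (window c) near = ≤-trans
    (*-monoˡ-≤ stride (m≤n+o⇒m∸n≤o (toℕ x) p (subst (toℕ x ≤_) (+-comm _ p) (covers⇒≤end (kept c) near))))
    (m≤n+m _ _)
  roleAdj⇒meets (bridge i) (core y) near = +-monoʳ-≤ (suc windows) (*-monoˡ-≤ stride (≤y near))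
    where
    ≤y : Near (bridge i) (toℕ y) → toℕ i ≤ toℕ y
    ≤y (inj₁ y≡) = ≤-reflexive (sym y≡)
    ≤y (inj₂ y≡) = ≤-trans (≤-trans (m≤m+n _ p) (n≤1+n _)) (≤-reflexive (sym y≡))
  roleAdj⇒meets (window c) (core y) near =
    +-mono-≤ (≤-trans (Finₚ.toℕ<n c) (n≤1+n windows)) (*-monoˡ-≤ stride (covers⇒start≤ (kept c) near))

  Active : ℕ → Role → Set
  Active t r = lo r ≤ t × t ≤ hi r

  module _ {t : ℕ} where

    -- The quotient `t / stride` is the current period, and the active core vertices lie in the
    -- window starting there.
    active⇒≥ : ∀ x → Active t (core x) → t / stride ≤ toℕ x
    active⇒≥ x (_ , t≤hi) = ≤-pred (m<n*o⇒m/o<n {t} {suc (toℕ x)} {stride} (s≤s t≤hi))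

    active⇒≤ : ∀ x → Active t (core x) → toℕ x ∸ t / stride ≤ p
    active⇒≤ x (lo≤t , _) = m≤n+o⇒m∸n≤o (toℕ x) (t / stride) (≤-trans (m≤n+m∸n (toℕ x) p)
      (≤-trans (≤-reflexive (+-comm p _)) (+-monoˡ-≤ p
        (subst (_≤ t / stride) (m*n/n≡m (toℕ x ∸ p) stride) (/-monoˡ-≤ stride lo≤t)))))

    -- If `i′ < i`, bridge `i′` is gone after the first moment of period `i` at the latest, while
    -- bridge `i` appears at its last moment.
    bridges-ordered : ∀ i i′ → Active t (bridge i) → Active t (bridge i′) → toℕ i ≤ toℕ i′
    bridges-ordered i i′ (lo≤t , _) (_ , t≤hi) = ≮⇒≥ λ i′<i →
      <⇒≱ (s≤s (≤-trans (*-monoˡ-≤ stride i′<i) (m≤n+m (toℕ i * stride) windows)))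
          (≤-trans lo≤t t≤hi)

    bridge-window-disjoint : ∀ i c → Active t (bridge i) → Active t (window c) → ⊥
    bridge-window-disjoint i c (lo≤t , t≤hi) (lo≤t′ , t≤hi′) with start (kept c) ≤? toℕ i
    ... | yes s≤i = <⇒≱ (+-mono-<-≤ (s≤s (Finₚ.toℕ<n c)) (*-monoˡ-≤ stride s≤i)) (≤-trans lo≤t t≤hi′)
    ... | no  s≰i = <⇒≱ (s≤s (≤-trans (*-monoˡ-≤ stride (≰⇒> s≰i)) (m≤n+m _ (toℕ c)))) (≤-trans lo≤t′ t≤hi)

    -- A window vertex is active at a single moment, whose residue modulo `stride` is `suc c`.
    windows-disjoint : ∀ c c′ → Active t (window c) → Active t (window c′) → c ≡ c′
    windows-disjoint c c′ (lo≤t , t≤hi) (lo≤t′ , t≤hi′) = Finₚ.toℕ-injective (suc-injective (begin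
      suc (toℕ c)                                        ≡⟨ offset c ⟨
      (suc (toℕ c) + start (kept c) * stride) % stride   ≡⟨ cong (_% stride) (trans (≤-antisym lo≤t t≤hi) (≤-antisym t≤hi′ lo≤t′)) ⟩
      (suc (toℕ c′) + start (kept c′) * stride) % stride ≡⟨ offset c′ ⟩
      suc (toℕ c′)                                       ∎))
      where
      open ≡-Reasoning
      offset : ∀ c → (suc (toℕ c) + start (kept c) * stride) % stride ≡ suc (toℕ c)
      offset c = trans ([m+kn]%n≡m%n (suc (toℕ c)) (start (kept c)) stride)
                       (m<n⇒m%n≡m (s≤s (≤-trans (Finₚ.toℕ<n c) (n≤1+n windows))))

    outer-disjoint : ∀ o o′ → Active t (inj₂ o) → Active t (inj₂ o′) → o ≡ o′
    outer-disjoint (inj₁ i) (inj₁ i′) a a′ = cong inj₁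
      (Finₚ.toℕ-injective (≤-antisym (bridges-ordered i i′ a a′) (bridges-ordered i′ i a′ a)))
    outer-disjoint (inj₁ i) (inj₂ c)  a a′ = ⊥-elim (bridge-window-disjoint i c a a′)
    outer-disjoint (inj₂ c) (inj₁ i)  a a′ = ⊥-elim (bridge-window-disjoint i c a′ a)
    outer-disjoint (inj₂ c) (inj₂ c′) a a′ = cong inj₂ (windows-disjoint c c′ a a′)

    -- Core vertices take the colours 0 to `p` by their position in the current window; all other
    -- vertices share `p + 1`, as at most one of them is active at a time.
    colour : Role → ℕ
    colour (core x) = toℕ x ∸ t / stride
    colour (inj₂ _) = suc p

    colour-bounded : ∀ r → Active t r → colour r < suc (suc p)
    colour-bounded (core x) a = s≤s (≤-trans (active⇒≤ x a) (n≤1+n p))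
    colour-bounded (inj₂ _) a = ≤-refl

    colour-injective : ∀ r r′ → Active t r → Active t r′ → colour r ≡ colour r′ → r ≡ r′
    colour-injective (core x) (core y) a a′ eq =
      cong inj₁ (Finₚ.toℕ-injective (∸-cancelʳ-≡ (active⇒≥ x a) (active⇒≥ y a′) eq))
    colour-injective (core x) (inj₂ _) a a′ eq = contradiction (active⇒≤ x a) (<⇒≱ (≤-reflexive (sym eq)))
    colour-injective (inj₂ _) (core y) a a′ eq = contradiction (active⇒≤ y a′) (<⇒≱ (≤-reflexive eq))
    colour-injective (inj₂ o) (inj₂ o′) a a′ eq = cong inj₂ (outer-disjoint o o′ a a′)

  decomposition : PathDecomposition graph
  decomposition = intervalDecomposition graph (lo ∘ role) (hi ∘ role) (k * stride)
    (lo≤hi ∘ role) (lo≤end ∘ role) (λ {u} {v} → roleAdj⇒meets (role u) (role v))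

  bag-bounded : ∀ j → ∣ PathDecomposition.bag decomposition j ∣ ≤ suc (suc p)
  bag-bounded j = ∣∣-upper _ (colour {toℕ j} ∘ role)
    (λ {v} v∈j → colour-bounded (role v) (active v∈j))
    (λ {u} {v} u∈j v∈j eq → role-injective (colour-injective (role u) (role v) (active u∈j) (active v∈j) eq))
    where
    active : ∀ {v} → v ∈ PathDecomposition.bag decomposition j → Active (toℕ j) (role v)
    active = ∈-tabulate⁻ (active? graph (lo ∘ role) (hi ∘ role) (k * stride)
      (lo≤hi ∘ role) (lo≤end ∘ role) (λ {u} {v} → roleAdj⇒meets (role u) (role v)) j)

  -- The pathwidth is at least w

  w<k : suc p < k
  w<k = s≤s (+-monoˡ-≤ p 0<d)

  clique : Fin (suc p) → Fin k
  clique j = Fin.inject≤ j (<⇒≤ w<k)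

  toℕ-clique : ∀ j → toℕ (clique j) ≡ toℕ j
  toℕ-clique j = Finₚ.toℕ-inject≤ j (<⇒≤ w<k)

  next : Fin k
  next = fromℕ< w<k

  bridge₀ : Fin d
  bridge₀ = fromℕ< 0<d

  next≢clique : ∀ j → next ≢ clique j
  next≢clique j eq = <-irrefl
    (sym (trans (sym (Finₚ.toℕ-fromℕ< w<k)) (trans (cong toℕ eq) (toℕ-clique j)))) (Finₚ.toℕ<n j)

  clique-adj : ∀ i j → i ≢ j → RoleAdj (core (clique i)) (core (clique j))
  clique-adj i j i≢j = (i≢j ∘ Finₚ.inject≤-injective _ _ i j) , near i j , near j i
    where
    near : ∀ i j → toℕ (clique j) ≤ toℕ (clique i) + p
    near i j = ≤-trans (≤-reflexive (toℕ-clique j)) (≤-trans (Finₚ.toℕ≤pred[n] j) (m≤n+m p _))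

  -- Of the first window only vertex 0 is out of reach, at distance `p + 1`; `bridge₀` makes up for
  -- it.
  next-adj : ∀ j → RoleAdj (core next) (core (clique (suc j)))
  next-adj j = next≢clique (suc j) ,
    ≤-trans (≤-reflexive (toℕ-clique (suc j))) (≤-trans (Finₚ.toℕ≤pred[n] (suc j)) (m≤n+m p _)) ,
    (≤-trans (≤-reflexive (Finₚ.toℕ-fromℕ< w<k)) (+-monoˡ-≤ p (≤-trans (s≤s z≤n) (≤-reflexive (sym (toℕ-clique (suc j)))))))

  bridge₀-adj : RoleAdj (bridge bridge₀) (core (clique zero))
  bridge₀-adj = inj₁ (trans (toℕ-clique zero) (sym (Finₚ.toℕ-fromℕ< 0<d)))

  bridge₀-next-adj : RoleAdj (bridge bridge₀) (core next)
  bridge₀-next-adj = inj₂ (trans (Finₚ.toℕ-fromℕ< w<k) (cong (λ i → suc (i + p)) (sym (Finₚ.toℕ-fromℕ< 0<d))))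

  module _ (D : PathDecomposition graph) where
    open PathDecomposition D using (last; bag; vertices; edges; interval)

    Has : Role → Fin (suc last) → Set
    Has r b = vertex r ∈ bag b

    edge : ∀ r r′ → RoleAdj r r′ → ∃[ b ] (Has r b × Has r′ b)
    edge r r′ adj = edges (subst₂ RoleAdj (sym (role-vertex r)) (sym (role-vertex r′)) adj)

    -- Contracting the edge between bridge 0 and core vertex w gives a clique
    -- with the core vertices 0, …, p.
    Branch : Fin (suc (suc p)) → Fin (suc last) → Set
    Branch zero    b = Has (bridge bridge₀) b ⊎ Has (core next) b
    Branch (suc j) b = Has (core (clique j)) b

    -- For the contracted pair, two intervals with a common index `q` have a convex union: compare
    -- `b` with `q` and stay within one of them on each side.
    branch-convex : ∀ i {a b c} → a Fin.≤ b → b Fin.≤ c → Branch i a → Branch i c → Branch i b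
    branch-convex (suc j) a≤b b≤c h h′ = interval a≤b b≤c h h′
    branch-convex zero a≤b b≤c (inj₁ h) (inj₁ h′) = inj₁ (interval a≤b b≤c h h′)
    branch-convex zero a≤b b≤c (inj₂ h) (inj₂ h′) = inj₂ (interval a≤b b≤c h h′)
    branch-convex zero {b = b} a≤b b≤c (inj₁ h) (inj₂ h′)
      with edge (bridge bridge₀) (core next) bridge₀-next-adj
    ... | q , g , g′ with Finₚ.≤-total b q
    ...   | inj₁ b≤q = inj₁ (interval a≤b b≤q h g)
    ...   | inj₂ q≤b = inj₂ (interval q≤b b≤c g′ h′)
    branch-convex zero {b = b} a≤b b≤c (inj₂ h) (inj₁ h′)
      with edge (bridge bridge₀) (core next) bridge₀-next-adj
    ... | q , g , g′ with Finₚ.≤-total b q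
    ...   | inj₁ b≤q = inj₂ (interval a≤b b≤q h g′)
    ...   | inj₂ q≤b = inj₁ (interval q≤b b≤c g h′)

    branch-clique : ∀ j → ∃[ b ] (Branch zero b × Branch (suc j) b)
    branch-clique zero =
      let b , h , h′ = edge (bridge bridge₀) (core (clique zero)) bridge₀-adj in b , inj₁ h , h′
    branch-clique (suc j) =
      let b , h , h′ = edge (core next) (core (clique (suc j))) (next-adj j) in b , inj₂ h , h′

    branches-meet : ∀ i j → ∃[ b ] (Branch i b × Branch j b)
    branches-meet zero zero =
      let b , h = vertices (vertex (bridge bridge₀)) in b , inj₁ h , inj₁ h
    branches-meet zero    (suc j) = branch-clique j
    branches-meet (suc i) zero    = let b , h , h′ = branch-clique i in b , h′ , h
    branches-meet (suc i) (suc j) with i Fin.≟ j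
    ... | yes refl = let b , h = vertices (vertex (core (clique i))) in b , h , h
    ... | no  i≢j  = edge (core (clique i)) (core (clique j)) (clique-adj i j i≢j)

    -- Here `r` is whichever vertex of the contracted pair the common bag contains.
    clique+1≤bag : ∀ {b} r → Has r b → (∀ j → r ≢ core (clique j)) →
                   (∀ j → Has (core (clique j)) b) → suc (suc p) ≤ ∣ bag b ∣
    clique+1≤bag {b} r r∈b r≢ all = ∣∣-lower (λ i → vertex (branch i))
      (λ {i} {j} eq → branch-injective {i} {j} (vertex-injective (branch i) (branch j) eq)) branch∈b
      where
      branch : Fin (suc (suc p)) → Role
      branch zero    = r
      branch (suc j) = core (clique j)
      vertex-injective : ∀ r r′ → vertex r ≡ vertex r′ → r ≡ r′
      vertex-injective r r′ eq = trans (sym (role-vertex r)) (trans (cong role eq) (role-vertex r′))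
      branch-injective : ∀ {i j} → branch i ≡ branch j → i ≡ j
      branch-injective {zero}  {zero}  _  = refl
      branch-injective {zero}  {suc j} eq = ⊥-elim (r≢ j eq)
      branch-injective {suc i} {zero}  eq = ⊥-elim (r≢ i (sym eq))
      branch-injective {suc i} {suc j} eq = cong suc (Finₚ.inject≤-injective _ _ i j (inj₁-injective eq))
      branch∈b : ∀ i → Has (branch i) b
      branch∈b zero    = r∈b
      branch∈b (suc j) = all j

    common-bag-large : ∀ b → (∀ i → Branch i b) → suc (suc p) ≤ ∣ bag b ∣
    common-bag-large b all = Sum.[
      (λ h → clique+1≤bag (bridge bridge₀) h (λ j ()) (λ j → all (suc j))) ,
      (λ h → clique+1≤bag (core next) h (λ j eq → next≢clique j (inj₁-injective eq)) (λ j → all (suc j))) ]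
      (all zero)

    large-bag : ∃[ b ] suc (suc p) ≤ ∣ bag b ∣
    large-bag = let b , all = helly Branch branch-convex branches-meet in b , common-bag-large b all

  graph-isPathwidth : IsPathwidth graph (+ suc p)
  graph-isPathwidth = isPathwidth decomposition bag-bounded large-bag

  -- The order of the graph

  graph-order : order graph ≡ (d + 2) * 2 ^ p + 2 * k ∸ suc p ∸ 2
  graph-order = begin
    k + (d + (codes ∸ 2))                      ≡⟨ cong (_+_ k) (+-∸-assoc d 2≤codes) ⟨
    k + (d + codes ∸ 2)                        ≡⟨ +-∸-assoc k (≤-trans 2≤codes (m≤n+m codes d)) ⟨
    -- Adding and removing `suc p` leaves an identity free of subtraction for the ring solver.
    k + (d + codes) ∸ 2                        ≡⟨ cong (_∸ 2) (m+n∸m≡n (suc p) _) ⟨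
    suc p + (k + (d + codes)) ∸ suc p ∸ 2      ≡⟨ cong (λ n → n ∸ suc p ∸ 2) (regroup d p (2 ^ p)) ⟩
    (d + 2) * 2 ^ p + 2 * k ∸ suc p ∸ 2        ∎
    where
    open ≡-Reasoning
    2≤codes : 2 ≤ codes
    2≤codes = ≤-trans (*-monoʳ-≤ 2 (m^n>0 2 p)) (m≤n+m (2 ^ suc p) (d * 2 ^ p))
    regroup : ∀ d p e → suc p + (suc (d + p) + (d + (d * e + 2 * e))) ≡ (d + 2) * e + 2 * suc (d + p)
    regroup = solve-∀

theorem8 : (w k : ℕ) → w ≥ 2 → k ≥ 2 * w ∸ 1 →
    ∃[ G ] (IsPathwidth G (+ w)
    × IsNC G k (order G)
    × order G ≡ (k ∸ w + 2) * 2 ^ (w ∸ 1) + 2 * k ∸ w ∸ 2)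
theorem8 (suc p) k (s≤s 1≤p) k≥2w-1 =
  graph , graph-isPathwidth , subst (λ k → IsNC graph k (order graph)) k≡ graph-isNC ,
  trans graph-order (cong (λ k → (d + 2) * 2 ^ p + 2 * k ∸ suc p ∸ 2) k≡)
  where
  -- With `w = p + 1`, the condition `k ≥ 2w - 1` says exactly that `p ≤ d`.
  d : ℕ
  d = k ∸ suc p
  p+w≤k : p + suc p ≤ k
  -- The bound `2 * suc p ∸ 1` reduces to `p + suc (p + 0)`.
  p+w≤k = subst (λ q → p + suc q ≤ k) (+-identityʳ p) k≥2w-1
  p≤d : p ≤ d
  p≤d = m+n≤o⇒m≤o∸n p p+w≤k
  k≡ : suc (d + p) ≡ k
  k≡ = trans (sym (+-suc d p)) (m∸n+n≡m (m+n≤o⇒n≤o p p+w≤k))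
  open Construction p d 1≤p p≤d hiding (k)
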